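{- Let $n$ be a positive integer. Every circled composition of $n$ is Wilf equivalent (as a circled composition) to a circled composition of $n$ of one of the following forms, where $(1^\circ)^{j}$ denotes $j$ consecutive circled parts $1^\circ$ and all $a_i$ are uncircled parts: (1) $(1^\circ)^n$; (2) $(1^\circ)^{k_0}\ a_1\ a_2\ \cdots\ a_k\ (1^\circ)^{k_1}\ a_{k+1}\ (1^\circ)^{k_2}$ with $k_0 \geq k_2$, $a_1 \geq a_2 \geq \cdots \geq a_k \geq a_{k+1}$, and $a_1,\dots,a_{k+1},k_0,k_2 \neq 2$; (3) $(1^\circ)^{k_0}\ a_1\ a_2\ \cdots\ a_k\ (1^\circ)^{k_2}$ with $k_0 \geq k_2$, $k_0,k_2 \neq 2$, $a_1 \geq a_2 \geq \cdots \geq a_k$, and, if $k \geq 2$, $a_1,\dots,a_k \neq 2$.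
   Context: A circled composition of $n$ is a pair $(a,C)$ where $a=(a_1,\dots,a_k)$ is a composition of $n$ (a sequence of positive integers summing to $n$) and $C \subseteq \{1,\dots,k\}$ is such that $1 \in C$, $k \in C$, and $a_i = 1$ for all $i \in C$. It is written as the sequence of parts, with the parts indexed by $C$ marked as circled (written $1^\circ$) and the others uncircled. A circled composition $X$ dominates a circled composition $Y$ if $Y$ can be obtained from $X$ as follows: select a subsequence of the parts of $X$; replace any uncircled number $k$ in it by some number in $\{1,\dots,k\}$; then, if the first or last term is an uncircled number $k$, replace it by $k$ circled parts $1^\circ$. Two circled compositions $X,Y$ are Wilf equivalent if for every $n \geq 1$ the number of circled compositions of $n$ dominating $X$ equals the number dominating $Y$. -}

module Defs where

open import Data.Nat using (ℕ; zero; suc; _+_; _≤_; _≥_)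
open import Data.List using (List; []; _∷_; _++_; _∷ʳ_; map; replicate; length)
open import Data.Nat.ListAction using (sum)
open import Data.Unit using (⊤)
open import Data.List.Relation.Binary.Sublist.Propositional using (_⊆_)
open import Data.List.Relation.Binary.Pointwise using (Pointwise)
open import Data.List.Relation.Unary.All using (All)
open import Data.List.Relation.Unary.Linked using (Linked)
open import Data.List.Relation.Unary.Unique.Propositional using (Unique)
open import Data.List.Membership.Propositional using (_∈_)
open import Data.Product using (Σ; ∃; ∃-syntax; _×_; _,_)
open import Data.Sum using (_⊎_)
open import Function.Bundles using (_⇔_)
open import Relation.Binary.PropositionalEquality using (_≡_; _≢_)

-- A part of a circled composition: a circled 1 (written 1°) or an uncircled
-- positive integer k (positivity is imposed by IsCC below).
data Part : Set where
  circ : Part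
  unc  : ℕ → Part

weight : Part → ℕ
weight circ    = 1
weight (unc k) = k

PosPart : Part → Set
PosPart circ    = ⊤
PosPart (unc k) = 1 ≤ k

IsCC : ℕ → List Part → Set
IsCC n X =
  All PosPart X ×
  (∃[ ys ] X ≡ circ ∷ ys) ×
  (∃[ zs ] X ≡ zs ∷ʳ circ) ×
  sum (map weight X) ≡ n

data Reduce : Part → Part → Set where
  circ↦circ : Reduce circ circ
  unc↦unc   : ∀ {k j} → 1 ≤ j → j ≤ k → Reduce (unc k) (unc j)

expandPart : Part → List Part
expandPart circ    = circ ∷ []
expandPart (unc k) = replicate k circ

expandLast : List Part → List Part
expandLast []           = []
expandLast (p ∷ [])     = expandPart p
expandLast (p ∷ q ∷ r)  = p ∷ expandLast (q ∷ r)

expandEnds : List Part → List Part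
expandEnds []          = []
expandEnds (p ∷ [])    = expandPart p
expandEnds (p ∷ q ∷ r) = expandPart p ++ expandLast (q ∷ r)

Dominates : List Part → List Part → Set
Dominates X Y =
  ∃[ S ] ∃[ S' ] (S ⊆ X × Pointwise Reduce S S' × Y ≡ expandEnds S')

HasCount : (List Part → Set) → ℕ → Set
HasCount P c =
  ∃[ L ] (Unique L × length L ≡ c × (∀ Z → (Z ∈ L) ⇔ P Z))

DominatingCC : ℕ → List Part → List Part → Set
DominatingCC m X Z = IsCC m Z × Dominates Z X

WilfEquiv : List Part → List Part → Set
WilfEquiv X Y =
  ∀ m → 1 ≤ m →
  ∃[ c ] (HasCount (DominatingCC m X) c × HasCount (DominatingCC m Y) c)

circs : ℕ → List Part
circs j = replicate j circ

uncs : List ℕ → List Part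
uncs = map unc

Decreasing : List ℕ → Set
Decreasing = Linked (λ a b → b ≤ a)

Form1 : ℕ → List Part → Set
Form1 n Y = Y ≡ circs n

Form2 : List Part → Set
Form2 Y =
  ∃[ k0 ] ∃[ k1 ] ∃[ k2 ] ∃[ as ] ∃[ b ]
    (Y ≡ circs k0 ++ uncs as ++ circs k1 ++ unc b ∷ circs k2) ×
    k0 ≥ k2 ×
    Decreasing (as ∷ʳ b) ×
    All (λ a → a ≢ 2) (as ∷ʳ b) × k0 ≢ 2 × k2 ≢ 2

Form3 : List Part → Set
Form3 Y =
  ∃[ k0 ] ∃[ k2 ] ∃[ as ]
    (Y ≡ circs k0 ++ uncs as ++ circs k2) ×
    k0 ≥ k2 × k0 ≢ 2 × k2 ≢ 2 ×
    Decreasing as ×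
    (2 ≤ length as → All (λ a → a ≢ 2) as)

{-# OPTIONS --safe #-}

-- Outside of the case X = (1°)^n, write X = (1°)^k ls (1°)^k' where ls starts and
-- ends with an uncircled part. Matching greedily from the left, a word that
-- dominates X factors uniquely as a minimal word containing the opening run,
-- then for each part l of ls a minimal word ending in a part that can be replaced
-- by l, then a word whose end contains the final run. All factors but the last
-- form prefix-free languages, hence the number of dominating words does not
-- depend on the order of ls. Moreover the generating functions of the factors
-- of 1°, 1 and 2 are x(1-x)/(1-2x), x/(1-x)² and x²/((1-x)(1-2x)), so a 2 may be
-- traded for 1° 1, and an opening (1°)² for 1° followed by a part 1. Reversal
-- exchanges k and k'. These moves lead to one of the normal forms.
module Submission where

open import Defs
open import Data.Nat
open import Data.Nat.Properties
open import Data.Nat.ListAction using (sum)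
open import Data.Nat.ListAction.Properties using (sum-++; sum-↭)
open import Data.List hiding (sum; find)
open import Data.List.Properties hiding (sum-++)
open import Data.List.Membership.Propositional using (_∈_; _∉_; find; lose)
open import Data.List.Membership.Propositional.Properties
open import Data.List.Relation.Unary.All using (All; []; _∷_)
import Data.List.Relation.Unary.All as All
import Data.List.Relation.Unary.All.Properties as All
open import Data.List.Relation.Unary.Any using (here; there; any?)
open import Data.List.Relation.Unary.AllPairs using ([]; _∷_)
open import Data.List.Relation.Unary.Linked using ([-])
open import Data.List.Relation.Unary.Unique.Propositional using (Unique)
import Data.List.Relation.Unary.Unique.Propositional.Properties as Unique
import Data.List.Relation.Unary.Unique.DecPropositional.Properties as UniqueDec
open import Data.List.Relation.Binary.Pointwise using (Pointwise; []; _∷_)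
open import Data.List.Relation.Binary.Permutation.Propositional
  using (_↭_; ↭-refl; ↭-sym; ↭-trans; prep; swap; ↭-reflexive)
import Data.List.Relation.Binary.Permutation.Propositional as Perm
import Data.List.Relation.Binary.Permutation.Propositional.Properties as Perm
open import Data.List.Relation.Binary.Sublist.Heterogeneous
  using (Sublist; []; _∷_) renaming (_∷ʳ_ to skip)
import Data.List.Relation.Binary.Sublist.Heterogeneous.Properties as Sublist
import Data.List.Relation.Binary.Sublist.Propositional as Sub
import Data.List.Sort
open import Data.Product using (∃₂; ∃-syntax; _×_; _,_; proj₁; proj₂)
open import Data.Sum using (_⊎_; inj₁; inj₂)
open import Data.Unit using (tt)
open import Function using (_∘_; id; flip; mk⇔; Equivalence; _⇔_)
open import Relation.Nullary using (Dec; yes; no; ¬_; contradiction)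
open import Relation.Nullary.Decidable using (map′; _×-dec_)
open import Relation.Unary using (Decidable)
import Relation.Binary.Construct.Flip.EqAndOrd as Flip
open import Relation.Binary.Definitions using (DecidableEquality)
open import Relation.Binary.PropositionalEquality hiding ([_])

-- Size-preserving bijections of languages

Lang : Set₁
Lang = List Part → Set

size : List Part → ℕ
size = sum ∘ map weight

size-++ : ∀ u v → size (u ++ v) ≡ size u + size v
size-++ u v = trans (cong sum (map-++ weight u v)) (sum-++ (map weight u) (map weight v))

_⟺_ : Lang → Lang → Set
P ⟺ Q = ∀ {z} → P z ⇔ Q z

infix 4 _≃_ _⟺_

-- A size-preserving bijection is given by its graph, so that it need not be
-- computable from the word alone and proofs of membership play no role.
record _≃_ (P Q : Lang) : Set₁ where
  field
    Graph      : List Part → List Part → Set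
    to         : ∀ {z} → P z → ∃[ z' ] (Q z' × Graph z z')
    from       : ∀ {z'} → Q z' → ∃[ z ] (P z × Graph z z')
    functional : ∀ {z a b} → Graph z a → Graph z b → a ≡ b
    injective  : ∀ {z a b} → Graph a z → Graph b z → a ≡ b
    size-≡     : ∀ {z z'} → Graph z z' → size z ≡ size z'

open _≃_

⟺⇒≃ : ∀ {P Q} → P ⟺ Q → P ≃ Q
⟺⇒≃ e = record
  { Graph      = _≡_
  ; to         = λ p → _ , Equivalence.to e p , refl
  ; from       = λ q → _ , Equivalence.from e q , refl
  ; functional = λ p q → trans (sym p) q
  ; injective  = λ p q → trans p (sym q)
  ; size-≡     = cong size
  }

≃-refl : ∀ {P} → P ≃ P
≃-refl = ⟺⇒≃ (mk⇔ id id)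

≃-sym : ∀ {P Q} → P ≃ Q → Q ≃ P
≃-sym e = record
  { Graph      = flip (Graph e)
  ; to         = from e
  ; from       = to e
  ; functional = injective e
  ; injective  = functional e
  ; size-≡     = sym ∘ size-≡ e
  }

≃-trans : ∀ {P Q S} → P ≃ Q → Q ≃ S → P ≃ S
≃-trans {P} {Q} {S} e f = record
  { Graph      = λ z z' → ∃[ y ] (Graph e z y × Graph f y z')
  ; to         = λ p → let (y , q , g) = to e p ; (x , s , h) = to f q in x , s , y , g , h
  ; from       = λ s → let (y , q , g) = from f s ; (x , p , h) = from e q in x , p , y , h , g
  ; functional = λ { (_ , g , h) (_ , g' , h') → functional f h (subst (λ y → Graph f y _) (functional e g' g) h') }
  ; injective  = λ { (_ , g , h) (_ , g' , h') → injective e g (subst (Graph e _) (injective f h' h) g') }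
  ; size-≡     = λ { (_ , g , h) → trans (size-≡ e g) (size-≡ f h) }
  }

-- The counting list is transported entry by entry. Injectivity of the graph keeps it free of
-- repetitions.
≃-HasCount : ∀ {P Q c} → P ≃ Q → HasCount P c → HasCount Q c
≃-HasCount {P} {Q} e (L , uniq , len , mem) =
  let (L' , pw) = image L (λ z∈L → Equivalence.to (mem _) z∈L)
  in L' , unique uniq pw , trans (sym (lengths pw)) len , λ z' → mk⇔
       (λ z'∈L' → let (z , _ , q , g) = preimage pw z'∈L' in q)
       -- The image that was chosen for `z` when the list was built need not be `z'` by definition;
       -- `functional` identifies the two.
       (λ q → let (z , p , g) = from e q
                  (z'' , z''∈ , _ , g') = forward pw (Equivalence.from (mem z) p)
              in subst (_∈ L') (functional e g' g) z''∈)
  where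
  G : List Part → List Part → Set
  G z z' = Q z' × Graph e z z'

  image : ∀ L → (∀ {z} → z ∈ L → P z) → ∃[ L' ] Pointwise G L L'
  image []      _ = [] , []
  image (z ∷ L) h =
    let (z' , g) = to e (h (here refl)) ; (L' , gs) = image L (h ∘ there)
    in z' ∷ L' , g ∷ gs

  lengths : ∀ {L L'} → Pointwise G L L' → length L ≡ length L'
  lengths []       = refl
  lengths (_ ∷ gs) = cong suc (lengths gs)

  preimage : ∀ {L L' z'} → Pointwise G L L' → z' ∈ L' → ∃[ z ] (z ∈ L × G z z')
  preimage (g ∷ _)  (here refl) = _ , here refl , g
  preimage (_ ∷ gs) (there m)   = let (z , z∈ , g) = preimage gs m in z , there z∈ , g

  forward : ∀ {L L' z} → Pointwise G L L' → z ∈ L → ∃[ z' ] (z' ∈ L' × G z z')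
  forward (g ∷ _)  (here refl) = _ , here refl , g
  forward (_ ∷ gs) (there m)   = let (z' , z'∈ , g) = forward gs m in z' , there z'∈ , g

  unique : ∀ {L L'} → Unique L → Pointwise G L L' → Unique L'
  unique []          []                  = []
  unique (z∉ ∷ uniq) (_∷_ {x = z} (_ , g) gs) =
    All.tabulate (λ {y} y∈ z'≡y → let (x , x∈ , _ , h) = preimage gs y∈ in
      All.lookup z∉ x∈ (injective e g (subst (Graph e x) (sym z'≡y) h)))
    ∷ unique uniq gs

-- Concatenation of prefix-free languages

infixr 5 _∙_

_∙_ : Lang → Lang → Lang
(A ∙ B) z = ∃₂ λ u v → z ≡ u ++ v × A u × B v

-- No member is a proper prefix of another, phrased in the form in which it is applied: two
-- factorisations of one word start with the same factor.
PrefixFree : Lang → Set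
PrefixFree A = ∀ {u u'} v v' → A u → A u' → u ++ v ≡ u' ++ v' → u ≡ u'

++-split : ∀ {A} → PrefixFree A → ∀ {u u'} v v' → A u → A u' → u ++ v ≡ u' ++ v' → u ≡ u' × v ≡ v'
++-split pf {u} v v' a a' eq with refl ← pf v v' a a' eq = refl , ++-cancelˡ u v v' eq

∙-prefixFree : ∀ {A B} → PrefixFree A → PrefixFree B → PrefixFree (A ∙ B)
∙-prefixFree pfA pfB w w' (u , v , refl , a , b) (u' , v' , refl , a' , b') eq
  with refl , eq' ← ++-split pfA (v ++ w) (v' ++ w') a a'
                      (trans (sym (++-assoc u v w)) (trans eq (++-assoc u' v' w')))
  = cong (u ++_) (pfB w w' b b' eq')

∙-assoc : ∀ {A B C} → (A ∙ B) ∙ C ⟺ A ∙ (B ∙ C)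
∙-assoc = mk⇔
  (λ { (_ , w , refl , (u , v , refl , a , b) , c) → u , v ++ w , ++-assoc u v w , a , v , w , refl , b , c })
  (λ { (u , _ , refl , a , v , w , refl , b , c) → u ++ v , w , sym (++-assoc u v w) , (u , v , refl , a , b) , c })

-- The factors are mapped separately. The graph records that they lie in `A` and `A'`, because the
-- cut of a word is unique only among cuts whose first factor belongs to the prefix-free language:
-- `A` on the source side, `A'` on the target side.
∙-cong : ∀ {A A' B B'} → PrefixFree A → PrefixFree A' → A ≃ A' → B ≃ B' → A ∙ B ≃ A' ∙ B'
∙-cong {A} {A'} pf pf' e f = record
  { Graph      = Gr
  ; to         = λ { (u , v , refl , a , b) → let (u' , a' , g) = to e a ; (v' , b' , h) = to f b in
                   u' ++ v' , (u' , v' , refl , a' , b') , u , v , u' , v' , refl , refl , (a , a') , g , h }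
  ; from       = λ { (u' , v' , refl , a' , b') → let (u , a , g) = from e a' ; (v , b , h) = from f b' in
                   u ++ v , (u , v , refl , a , b) , u , v , u' , v' , refl , refl , (a , a') , g , h }
  ; functional = fun
  ; injective  = inj
  ; size-≡     = λ { (u , v , u' , v' , refl , refl , _ , g , h) →
                   trans (size-++ u v) (trans (cong₂ _+_ (size-≡ e g) (size-≡ f h)) (sym (size-++ u' v'))) }
  }
  where
  Gr : List Part → List Part → Set
  Gr z z' = ∃₂ λ u v → ∃₂ λ u' v' → z ≡ u ++ v × z' ≡ u' ++ v' ×
              (A u × A' u') × Graph e u u' × Graph f v v'
  fun : ∀ {z a b} → Gr z a → Gr z b → a ≡ b
  fun (u , v , _ , _ , p , refl , (a , _) , g , h) (u₁ , v₁ , _ , _ , q , refl , (a₁ , _) , g₁ , h₁)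
    with refl , refl ← ++-split pf v v₁ a a₁ (trans (sym p) q)
    = cong₂ _++_ (functional e g g₁) (functional f h h₁)
  inj : ∀ {z a b} → Gr a z → Gr b z → a ≡ b
  inj (_ , _ , u , v , refl , p , (_ , a) , g , h) (_ , _ , u₁ , v₁ , refl , q , (_ , a₁) , g₁ , h₁)
    with refl , refl ← ++-split pf' v v₁ a a₁ (trans (sym p) q)
    = cong₂ _++_ (injective e g g₁) (injective f h h₁)

∙-congʳ : ∀ {A B B'} → PrefixFree A → B ≃ B' → A ∙ B ≃ A ∙ B'
∙-congʳ pf = ∙-cong pf pf ≃-refl

-- The two factors trade places. Prefix-freeness of `A` makes the cut unique before the exchange,
-- that of `B` after it.
∙-comm : ∀ {A B} → PrefixFree A → PrefixFree B → A ∙ B ≃ B ∙ A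
∙-comm {A} {B} pfA pfB = record
  { Graph      = Gr
  ; to         = λ { (u , v , refl , a , b) → v ++ u , (v , u , refl , b , a) , u , v , refl , refl , a , b }
  ; from       = λ { (v , u , refl , b , a) → u ++ v , (u , v , refl , a , b) , u , v , refl , refl , a , b }
  ; functional = fun
  ; injective  = inj
  ; size-≡     = λ { (u , v , refl , refl , _) →
                   trans (size-++ u v) (trans (+-comm (size u) _) (sym (size-++ v u))) }
  }
  where
  Gr : List Part → List Part → Set
  Gr z z' = ∃₂ λ u v → z ≡ u ++ v × z' ≡ v ++ u × A u × B v
  fun : ∀ {z a b} → Gr z a → Gr z b → a ≡ b
  fun (u , v , p , refl , a , _) (u₁ , v₁ , q , refl , a₁ , _)
    with refl , refl ← ++-split pfA v v₁ a a₁ (trans (sym p) q) = refl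
  inj : ∀ {z a b} → Gr a z → Gr b z → a ≡ b
  inj (u , v , refl , p , _ , b) (u₁ , v₁ , refl , q , _ , b₁)
    with refl , refl ← ++-split pfB u u₁ b b₁ (trans (sym p) q) = refl

∙-swap : ∀ {A B C} → PrefixFree A → PrefixFree B → A ∙ B ∙ C ≃ B ∙ A ∙ C
∙-swap pfA pfB =
  ≃-trans (≃-sym (⟺⇒≃ ∙-assoc))
    (≃-trans (∙-cong (∙-prefixFree pfA pfB) (∙-prefixFree pfB pfA) (∙-comm pfA pfB) ≃-refl)
      (⟺⇒≃ ∙-assoc))

-- Enumeration of dominating words

_≟ᴾ_ : DecidableEquality Part
circ  ≟ᴾ circ  = yes refl
circ  ≟ᴾ unc _ = no λ ()
unc _ ≟ᴾ circ  = no λ ()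
unc a ≟ᴾ unc b = map′ (cong unc) (λ { refl → refl }) (a ≟ b)

_≟ᵂ_ : DecidableEquality (List Part)
_≟ᵂ_ = ≡-dec _≟ᴾ_

reduce? : ∀ x y → Dec (Reduce x y)
reduce? circ    circ    = yes circ↦circ
reduce? circ    (unc _) = no λ ()
reduce? (unc _) circ    = no λ ()
reduce? (unc a) (unc b) = map′ (λ (p , q) → unc↦unc p q) (λ { (unc↦unc p q) → p , q }) (1 ≤? b ×-dec b ≤? a)

infix 4 _≼_

-- Selecting a subsequence and reducing its terms are merged into one relation, so that a single
-- induction handles both.
_≼_ : List Part → List Part → Set
_≼_ = Sublist (flip Reduce)

Occurs : Lang → Lang
Occurs P Z = ∃[ S ] (S ≼ Z × P S)

Dominates⟺Occurs : ∀ {X Z} → Dominates Z X ⇔ Occurs (λ S → X ≡ expandEnds S) Z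
Dominates⟺Occurs {X} = mk⇔
  (λ (_ , S' , S⊆Z , S↦S' , eq) → S' , reducing S⊆Z S↦S' , eq)
  (λ (S' , S'≼Z , eq) → let (S , S⊆Z , S↦S') = selecting S'≼Z in S , S' , S⊆Z , S↦S' , eq)
  where
  reducing : ∀ {S S' Z} → S Sub.⊆ Z → Pointwise Reduce S S' → S' ≼ Z
  reducing []          []       = []
  reducing (skip z s)   r        = skip z (reducing s r)
  reducing (refl ∷ s)  (r ∷ rs) = r ∷ reducing s rs

  selecting : ∀ {S' Z} → S' ≼ Z → ∃[ S ] (S Sub.⊆ Z × Pointwise Reduce S S')
  selecting []       = [] , [] , []
  selecting (skip z s) = let (S , p , q) = selecting s in S , skip z p , q
  selecting (r ∷ s)  = let (S , p , q) = selecting s in _ ∷ S , refl ∷ p , r ∷ q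

words : ℕ → ℕ → List (List Part)
words m zero    = [ [] ]
words m (suc l) = [] ∷ cartesianProductWith _∷_ (circ ∷ map unc (upTo (suc m))) (words m l)

∈-words : ∀ m l {Z} → length Z ≤ l → All (λ p → weight p ≤ m) Z → Z ∈ words m l
∈-words m zero    {[]}    _  _ = here refl
∈-words m (suc l) {[]}    _  _ = here refl
∈-words m (suc l) {p ∷ Z} (s≤s len) (p≤ ∷ Z≤) =
  there (∈-cartesianProductWith⁺ _∷_ (∈-letters p p≤) (∈-words m l len Z≤))
  where
  ∈-letters : ∀ p → weight p ≤ m → p ∈ circ ∷ map unc (upTo (suc m))
  ∈-letters circ    _   = here refl
  ∈-letters (unc k) k≤m = there (∈-map⁺ unc (∈-upTo⁺ (s≤s k≤m)))

length≤size : ∀ {Z} → All PosPart Z → length Z ≤ size Z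
length≤size []                = z≤n
length≤size {circ ∷ _}  (_ ∷ ps) = s≤s (length≤size ps)
length≤size {unc _ ∷ _} (p ∷ ps) = +-mono-≤ p (length≤size ps)

weights≤size : ∀ Z → All (λ p → weight p ≤ size Z) Z
weights≤size []      = []
weights≤size (p ∷ Z) = m≤m+n _ _ ∷ All.map (λ q → ≤-trans q (m≤n+m _ (weight p))) (weights≤size Z)

≼-weights : ∀ {m S Z} → S ≼ Z → All (λ p → weight p ≤ m) Z → All (λ p → weight p ≤ m) S
≼-weights []       _        = []
≼-weights (skip _ s) (_ ∷ qs) = ≼-weights s qs
≼-weights (r ∷ s)  (q ∷ qs) = ≤-trans (weight-mono r) q ∷ ≼-weights s qs
  where
  weight-mono : ∀ {x y} → Reduce x y → weight y ≤ weight x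
  weight-mono circ↦circ     = ≤-refl
  weight-mono (unc↦unc _ q) = q

-- A finite search: a reduced subsequence of `Z` is no longer than `Z`, and reduction does not
-- increase weights.
dominates? : ∀ X Z → Dec (Dominates Z X)
dominates? X Z =
  map′ (λ any → let (S , _ , p) = find any in Equivalence.from Dominates⟺Occurs (S , p))
       (λ d → let (S , s , eq) = Equivalence.to Dominates⟺Occurs d in
         lose (∈-words _ _ (Sublist.length-mono-≤ s) (≼-weights s (weights≤size Z))) (s , eq))
       (any? (λ S → Sublist.sublist? (flip reduce?) S Z ×-dec X ≟ᵂ expandEnds S) (words (size Z) (length Z)))

posPart? : Decidable PosPart
posPart? circ    = yes tt
posPart? (unc k) = 1 ≤? k

StartsCircled EndsCircled : Lang
StartsCircled Z = ∃[ ys ] Z ≡ circ ∷ ys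
EndsCircled   Z = ∃[ zs ] Z ≡ zs ∷ʳ circ

startsCircled? : Decidable StartsCircled
startsCircled? []          = no λ ()
startsCircled? (circ ∷ Z)  = yes (Z , refl)
startsCircled? (unc _ ∷ _) = no λ ()

endsCircled? : Decidable EndsCircled
endsCircled? Z with initLast Z
... | []           = no λ { ([] , ()) ; (_ ∷ _ , ()) }
... | zs ∷ʳ′ circ  = yes (zs , refl)
... | zs ∷ʳ′ unc k = no λ (ys , eq) → contradiction (∷ʳ-injectiveʳ zs ys eq) λ ()

Dominating : List Part → Lang
Dominating X Z = All PosPart Z × StartsCircled Z × EndsCircled Z × Dominates Z X

-- Positive parts of total size `m` number at most `m` and have weight at most `m`, so all
-- candidates occur in `words m m`. Deduplication avoids an argument that this list has no
-- repetitions.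
count-dominating : ∀ m X → ∃[ c ] HasCount (DominatingCC m X) c
count-dominating m X = _ , filter dom? candidates , Unique.filter⁺ dom? (UniqueDec.deduplicate-! _≟ᵂ_ (words m m)) , refl ,
  λ Z → mk⇔ (λ Z∈ → proj₂ (∈-filter⁻ dom? {xs = candidates} Z∈))
            (λ d → ∈-filter⁺ dom? (∈-deduplicate⁺ _≟ᵂ_ (candidate d)) d)
  where
  candidates : List (List Part)
  candidates = deduplicate _≟ᵂ_ (words m m)
  dom? : Decidable (DominatingCC m X)
  dom? Z = (All.all? posPart? Z ×-dec startsCircled? Z ×-dec endsCircled? Z ×-dec size Z ≟ m)
           ×-dec dominates? X Z
  candidate : ∀ {Z} → DominatingCC m X Z → Z ∈ words m m
  candidate {Z} ((pos , _ , _ , refl) , _) = ∈-words _ _ (length≤size pos) (weights≤size Z)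

≃⇒WilfEquiv : ∀ {X Y} → Dominating X ≃ Dominating Y → WilfEquiv X Y
≃⇒WilfEquiv {X} {Y} e m _ = let (c , h) = count-dominating m X in c , h , ≃-HasCount e' h
  where
  e' : DominatingCC m X ≃ DominatingCC m Y
  e' = record
    { Graph      = λ z z' → Graph e z z' × size z ≡ m
    ; to         = λ { ((p , s , t , refl) , d) → let (z' , (p' , s' , t' , d') , g) = to e (p , s , t , d) in
                     z' , ((p' , s' , t' , sym (size-≡ e g)) , d') , g , refl }
    ; from       = λ { ((p , s , t , refl) , d) → let (z , (p' , s' , t' , d') , g) = from e (p , s , t , d) in
                     z , ((p' , s' , t' , size-≡ e g) , d') , g , size-≡ e g }
    ; functional = λ (g , _) (h , _) → functional e g h
    ; injective  = λ (g , _) (h , _) → injective e g h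
    ; size-≡     = λ (g , _) → size-≡ e g
    }

-- Exchanging the parts of a pattern

-- The word stops at its first letter that can be replaced by `l`. This is greedy matching, and it
-- makes the language prefix-free.
data Hit (l : Part) : Lang where
  hit  : ∀ {x} → PosPart x → Reduce x l → Hit l [ x ]
  miss : ∀ {x w} → PosPart x → ¬ Reduce x l → Hit l w → Hit l (x ∷ w)

hit-positive : ∀ {l w} → Hit l w → All PosPart w
hit-positive (hit p _)    = p ∷ []
hit-positive (miss p _ h) = p ∷ hit-positive h

hit-prefixFree : ∀ l → PrefixFree (Hit l)
hit-prefixFree l v v' (hit _ _)    (hit _ _)      refl = refl
hit-prefixFree l v v' (hit _ r)    (miss _ ¬r _)  refl = contradiction r ¬r
hit-prefixFree l v v' (miss _ ¬r _) (hit _ r)     refl = contradiction r ¬r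
hit-prefixFree l v v' (miss _ _ h) (miss _ _ h')  eq   =
  cong₂ _∷_ (∷-injectiveˡ eq) (hit-prefixFree l v v' h h' (∷-injectiveʳ eq))

Hits : List Part → Lang → Lang
Hits ls T = foldr (λ l → Hit l ∙_) T ls

hits-cong : ∀ {T T'} ls → T ≃ T' → Hits ls T ≃ Hits ls T'
hits-cong []       e = e
hits-cong (l ∷ ls) e = ∙-congʳ (hit-prefixFree l) (hits-cong ls e)

hits-↭ : ∀ {T ls ls'} → ls ↭ ls' → Hits ls T ≃ Hits ls' T
hits-↭ Perm.refl         = ≃-refl
hits-↭ (prep l p)        = ∙-congʳ (hit-prefixFree l) (hits-↭ p)
hits-↭ (swap l l' p)     =
  ≃-trans (∙-swap (hit-prefixFree l) (hit-prefixFree l'))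
    (∙-congʳ (hit-prefixFree l') (∙-congʳ (hit-prefixFree l) (hits-↭ p)))
hits-↭ (Perm.trans p q)  = ≃-trans (hits-↭ p) (hits-↭ q)

circs-unc-injective : ∀ i i' {x x' z z'} → circs i ++ unc x ∷ z ≡ circs i' ++ unc x' ∷ z' →
                      i ≡ i' × x ≡ x' × z ≡ z'
circs-unc-injective zero    zero     refl = refl , refl , refl
circs-unc-injective (suc i) (suc i') eq   =
  let (p , q) = circs-unc-injective i i' (∷-injectiveʳ eq) in cong suc p , q

size-circs-++ : ∀ i w → size (circs i ++ w) ≡ i + size w
size-circs-++ zero    w = refl
size-circs-++ (suc i) w = cong suc (size-circs-++ i w)

hit-unc1-circs : ∀ i j → Hit (unc 1) (circs i ++ [ unc (suc j) ])
hit-unc1-circs zero    j = hit (s≤s z≤n) (unc↦unc (s≤s z≤n) (s≤s z≤n))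
hit-unc1-circs (suc i) j = miss tt (λ ()) (hit-unc1-circs i j)

-- Every positive uncircled part can be replaced by 1, so only circles can precede the first hit.
hit-unc1⁻ : ∀ {w} → Hit (unc 1) w → ∃₂ λ i j → w ≡ circs i ++ [ unc (suc j) ]
hit-unc1⁻ (hit {unc (suc j)} _ _)  = 0 , j , refl
hit-unc1⁻ (miss {circ} _ _ h)      = let (i , j , eq) = hit-unc1⁻ h in suc i , j , cong (circ ∷_) eq
hit-unc1⁻ (miss {unc (suc _)} _ ¬r _) = contradiction (unc↦unc (s≤s z≤n) (s≤s z≤n)) ¬r

-- A word of letters 1° and 1 followed by an uncircled part > 1 is cut after
-- each of its 1s: the block (1°)^a 1 becomes the uncircled part a + 1, and the
-- remaining (1°)^i (j + 2) becomes 1° (1°)^i (j + 1).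
data Cut : List Part → List Part → Set where
  final  : ∀ i j → Cut (circs i ++ [ unc (2 + j) ]) (circ ∷ circs i ++ [ unc (suc j) ])
  block : ∀ a {z z'} → Cut z z' → Cut (circs a ++ unc 1 ∷ z) (unc (suc a) ∷ z')

-- In the image of `Cut` the uncircled blocks together with the first circle form the factor from
-- `Hit circ`, and what follows lies in `Hit (unc 1)`. The block sizes and the final run can be read
-- off again, so cutting is reversible.
hit-unc2 : Hit (unc 2) ≃ Hit circ ∙ Hit (unc 1)
hit-unc2 = record
  { Graph      = Cut
  ; to         = λ h → let (z' , c) = cut h in z' , codomain c , c
  ; from       = λ { (u , v , refl , h , h') → let (z , c) = uncut h h' in z , domain c , c }
  ; functional = λ c d → functional' c d refl
  ; injective  = λ c d → injective' c d refl
  ; size-≡     = size-cut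
  }
  where
  hit-circs : ∀ a {z} → Hit (unc 2) z → Hit (unc 2) (circs a ++ z)
  hit-circs zero    h = h
  hit-circs (suc a) h = miss tt (λ ()) (hit-circs a h)

  domain : ∀ {z z'} → Cut z z' → Hit (unc 2) z
  domain (final i j)  = hit-circs i (hit (s≤s z≤n) (unc↦unc (s≤s z≤n) (s≤s (s≤s z≤n))))
  domain (block a c) = hit-circs a (miss (s≤s z≤n) (λ { (unc↦unc _ (s≤s ())) }) (domain c))

  codomain : ∀ {z z'} → Cut z z' → (Hit circ ∙ Hit (unc 1)) z'
  codomain (final i j)  = [ circ ] , _ , refl , hit tt circ↦circ , hit-unc1-circs i j
  codomain (block a c) = let (u , v , eq , h , h') = codomain c in
    unc (suc a) ∷ u , v , cong (_ ∷_) eq , miss (s≤s z≤n) (λ ()) h , h'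

  prepend : ∀ {z z'} → Cut z z' → ∃[ y ] Cut (circ ∷ z) y
  prepend (final i j)  = _ , final (suc i) j
  prepend (block a c) = _ , block (suc a) c

  cut : ∀ {z} → Hit (unc 2) z → ∃[ z' ] Cut z z'
  cut (hit {unc (suc (suc j))} _ _) = _ , final 0 j
  cut (hit {unc 1} _ (unc↦unc _ (s≤s ())))
  cut (miss {circ} _ _ h)           = prepend (proj₂ (cut h))
  cut (miss {unc 1} _ _ h)          = _ , block 0 (proj₂ (cut h))
  cut (miss {unc (suc (suc _))} _ ¬r _) = contradiction (unc↦unc (s≤s z≤n) (s≤s (s≤s z≤n))) ¬r

  uncut : ∀ {u v} → Hit circ u → Hit (unc 1) v → ∃[ z ] Cut z (u ++ v)
  uncut (hit {circ} _ _) h' with i , j , refl ← hit-unc1⁻ h' = _ , final i j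
  uncut (miss {circ} _ ¬r _) _      = contradiction circ↦circ ¬r
  uncut (miss {unc (suc a)} _ _ h) h' = _ , block a (proj₂ (uncut h h'))

  functional' : ∀ {y z a b} → Cut y a → Cut z b → y ≡ z → a ≡ b
  functional' (final i j) (final i' j') eq with refl , refl , _ ← circs-unc-injective i i' eq = refl
  -- The first uncircled part of the source is at least 2 in one case and 1 in the other.
  functional' (final i j) (block a d)  eq with () ← proj₁ (proj₂ (circs-unc-injective i a eq))
  functional' (block a c) (final i j)  eq with () ← proj₁ (proj₂ (circs-unc-injective a i eq))
  functional' (block a c) (block b d) eq with refl , refl , eq' ← circs-unc-injective a b eq =
    cong (unc (suc a) ∷_) (functional' c d eq')

  injective' : ∀ {y z a b} → Cut a y → Cut b z → y ≡ z → a ≡ b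
  injective' (final i j) (final i' j') eq
    with refl , refl , _ ← circs-unc-injective (suc i) (suc i') eq = refl
  injective' (block a c) (block b d) eq with refl , eq' ← ∷-injective eq =
    cong (λ z → circs a ++ unc 1 ∷ z) (injective' c d eq')

  size-cut : ∀ {z z'} → Cut z z' → size z ≡ size z'
  size-cut (final i j) = trans (size-circs-++ i _)
    (trans (+-suc i _) (cong suc (sym (size-circs-++ i _))))
  size-cut (block a {z} c) = trans (size-circs-++ a _)
    (trans (+-suc a (size z)) (cong (λ n → suc (a + n)) (size-cut c)))

-- The word leads from the number s of circled parts to at least k of them,
-- where an uncircled part a provides up to a of them but discards those before.
data Climb (k : ℕ) : ℕ → Lang where
  done : ∀ {s} → k ≤ s → Climb k s []
  circ : ∀ {s w} → s < k → Climb k (suc s) w → Climb k s (circ ∷ w)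
  unc  : ∀ {s a w} → s < k → 1 ≤ a → Climb k (s ⊔ a) w → Climb k s (unc a ∷ w)

climb-prefixFree : ∀ {k s} → PrefixFree (Climb k s)
climb-prefixFree v v' (done _)   (done _)   _  = refl
climb-prefixFree v v' (done p)   (circ q _) _  = contradiction p (<⇒≱ q)
climb-prefixFree v v' (done p)   (unc q _ _) _ = contradiction p (<⇒≱ q)
climb-prefixFree v v' (circ q _) (done p)   _  = contradiction p (<⇒≱ q)
climb-prefixFree v v' (unc q _ _) (done p)  _  = contradiction p (<⇒≱ q)
climb-prefixFree v v' (circ _ c) (circ _ d) eq =
  cong (circ ∷_) (climb-prefixFree v v' c d (∷-injectiveʳ eq))
climb-prefixFree v v' (unc _ _ c) (unc _ _ d) eq with refl , eq' ← ∷-injective eq =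
  cong (_ ∷_) (climb-prefixFree v v' c d eq')

-- A dominating word begins with a circle, which already supplies one; hence the climb starts at 1.
Opening : ℕ → Lang
Opening k z = ∃[ w ] (z ≡ circ ∷ w × Climb k 1 w)

opening-prefixFree : ∀ k → PrefixFree (Opening k)
opening-prefixFree k v v' (_ , refl , c) (_ , refl , d) eq =
  cong (circ ∷_) (climb-prefixFree v v' c d (∷-injectiveʳ eq))

-- `Opening 1` consists of the word `[ circ ]`. A climb from 1 to 2 is a run of 1s ended by a circle
-- or by a part of size at least 2. Turning the 1s into circles, and a final circle into a 1, yields
-- exactly the words of `Hit (unc 1)`.
opening-2 : Opening 2 ≃ Opening 1 ∙ Hit (unc 1)
opening-2 = record
  { Graph      = λ z z' → ∃₂ λ w w' → z ≡ circ ∷ w × z' ≡ circ ∷ w' × Swap w w'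
  ; to         = λ { (w , refl , c) → let (w' , h , s) = to' c in
                   circ ∷ w' , ([ circ ] , w' , refl , ([] , refl , done (s≤s z≤n)) , h) , w , w' , refl , refl , s }
  ; from       = from'
  ; functional = λ { (_ , _ , refl , refl , s) (_ , _ , refl , refl , t) → cong (circ ∷_) (functional' s t) }
  ; injective  = λ { (_ , _ , refl , refl , s) (_ , _ , refl , refl , t) → cong (circ ∷_) (injective' s t) }
  ; size-≡     = λ { (_ , _ , refl , refl , s) → cong suc (size-swap s) }
  }
  where
  data Swap : List Part → List Part → Set where
    one  : Swap [ circ ] [ unc 1 ]
    many : ∀ j → Swap [ unc (2 + j) ] [ unc (2 + j) ]
    step : ∀ {w w'} → Swap w w' → Swap (unc 1 ∷ w) (circ ∷ w')

  to' : ∀ {w} → Climb 2 1 w → ∃[ w' ] (Hit (unc 1) w' × Swap w w')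
  to' (done (s≤s ()))
  to' (circ _ (done _)) = _ , hit-unc1-circs 0 0 , one
  to' (circ _ (circ (s≤s (s≤s ())) _))
  to' (circ _ (unc (s≤s (s≤s ())) _ _))
  to' (unc {a = 1} _ _ c) = let (w' , h , s) = to' c in circ ∷ w' , miss tt (λ ()) h , step s
  to' (unc {a = suc (suc j)} _ _ (done _)) = _ , hit-unc1-circs 0 (suc j) , many j
  to' (unc {a = suc (suc j)} _ _ (circ (s≤s (s≤s ())) _))
  to' (unc {a = suc (suc j)} _ _ (unc (s≤s (s≤s ())) _ _))

  from″ : ∀ {w'} → Hit (unc 1) w' → ∃[ w ] (Climb 2 1 w × Swap w w')
  from″ (hit {unc 1} _ _)             = _ , circ (s≤s (s≤s z≤n)) (done (s≤s (s≤s z≤n))) , one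
  from″ (hit {unc (suc (suc j))} _ _) = _ , unc (s≤s (s≤s z≤n)) (s≤s z≤n) (done (s≤s (s≤s z≤n))) , many j
  from″ (miss {circ} _ _ h)           = let (w , c , s) = from″ h in
    unc 1 ∷ w , unc (s≤s (s≤s z≤n)) (s≤s z≤n) c , step s
  from″ (miss {unc (suc _)} _ ¬r _)   = contradiction (unc↦unc (s≤s z≤n) (s≤s z≤n)) ¬r

  from' : ∀ {z'} → (Opening 1 ∙ Hit (unc 1)) z' →
          ∃[ z ] (Opening 2 z × (∃₂ λ w w' → z ≡ circ ∷ w × z' ≡ circ ∷ w' × Swap w w'))
  from' (_ , w' , refl , (_ , refl , done _) , h) =
    let (w , c , s) = from″ h in circ ∷ w , (w , refl , c) , w , w' , refl , refl , s
  from' (_ , _ , _ , (_ , _ , circ (s≤s ()) _) , _)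
  from' (_ , _ , _ , (_ , _ , unc (s≤s ()) _ _) , _)

  functional' : ∀ {w a b} → Swap w a → Swap w b → a ≡ b
  functional' one      one      = refl
  functional' (many _) (many _) = refl
  functional' (step s) (step t) = cong (circ ∷_) (functional' s t)

  injective' : ∀ {w a b} → Swap a w → Swap b w → a ≡ b
  injective' one      one      = refl
  injective' (many _) (many _) = refl
  injective' (step s) (step t) = cong (unc 1 ∷_) (injective' s t)

  size-swap : ∀ {w w'} → Swap w w' → size w ≡ size w'
  size-swap one      = refl
  size-swap (many _) = refl
  size-swap (step s) = cong suc (size-swap s)

-- Greedy factorisation of dominating words

unc∉circs : ∀ {b} k → unc b ∉ circs k
unc∉circs (suc k) (there m) = unc∉circs k m

unc∉expandPart : ∀ {b} p → unc b ∉ expandPart p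
unc∉expandPart circ    (here ())
unc∉expandPart (unc k) m = unc∉circs k m

++-nonempty : ∀ {A : Set} (xs : List A) {ys} → ys ≢ [] → xs ++ ys ≢ []
++-nonempty []      ys≢[] = ys≢[]
++-nonempty (_ ∷ _) _     = λ ()

expandLast-++ : ∀ S {T} → T ≢ [] → expandLast (S ++ T) ≡ S ++ expandLast T
expandLast-++ []          T≢[] = refl
expandLast-++ (p ∷ [])    {[]}    T≢[] = contradiction refl T≢[]
expandLast-++ (p ∷ [])    {_ ∷ _} T≢[] = refl
expandLast-++ (p ∷ q ∷ S) T≢[] = cong (p ∷_) (expandLast-++ (q ∷ S) T≢[])

expandEnds-∷ : ∀ p {T} → T ≢ [] → expandEnds (p ∷ T) ≡ expandPart p ++ expandLast T
expandEnds-∷ p {[]}    T≢[] = contradiction refl T≢[]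
expandEnds-∷ p {_ ∷ _} T≢[] = refl

-- A one-term `S` would expand to circles only, which the occurrence of `unc b` excludes; so the
-- first term is not the one that gets expanded.
expandLast-uncons : ∀ {b l X} S → l ∷ X ≡ expandLast S → unc b ∈ l ∷ X → X ≢ [] →
                    ∃[ T ] (S ≡ l ∷ T × X ≡ expandLast T)
expandLast-uncons {b} (p ∷ []) eq b∈ X≢[] = contradiction (subst (unc b ∈_) eq b∈) (unc∉expandPart p)
expandLast-uncons (p ∷ q ∷ S) refl b∈ X≢[] = q ∷ S , refl , refl

endsCircled-++ : ∀ u {v} → EndsCircled v → EndsCircled (u ++ v)
endsCircled-++ u (zs , refl) = u ++ zs , sym (++-assoc u zs [ circ ])

endsCircled-++⁻ : ∀ u {v} → v ≢ [] → EndsCircled (u ++ v) → EndsCircled v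
endsCircled-++⁻ u {v} v≢[] (zs , eq) with initLast v
... | []      = contradiction refl v≢[]
... | vs ∷ʳ′ x = vs , cong (vs ∷ʳ_) (∷ʳ-injectiveʳ (u ++ vs) zs (trans (++-assoc u vs [ x ]) eq))

-- Domination as seen by a tail of the word: only the last selected term is expanded, and nothing is
-- required of the first letter.
Ending : List Part → Lang
Ending X Z = All PosPart Z × EndsCircled Z × Occurs (λ S → X ≡ expandLast S) Z

≼-nonempty : ∀ {S Z} → S ≼ Z → S ≢ [] → Z ≢ []
≼-nonempty [] S≢[] refl = S≢[] refl

expandLast-nonempty : ∀ {X S} → X ≡ expandLast S → X ≢ [] → S ≢ []
expandLast-nonempty refl X≢[] refl = X≢[] refl

ending-++ : ∀ {X} u {v} → All PosPart u → Ending X v → Ending X (u ++ v)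
ending-++ u p (q , e , S , s , eq) = All.++⁺ p q , endsCircled-++ u e , S , Sublist.++ˡ u s , eq

ending-++⁻ : ∀ {X} u {v} → X ≢ [] → All PosPart (u ++ v) → EndsCircled (u ++ v) →
             Occurs (λ S → X ≡ expandLast S) v → Ending X v
ending-++⁻ u X≢[] p e (S , s , eq) =
  All.++⁻ʳ u p , endsCircled-++⁻ u (≼-nonempty s (expandLast-nonempty eq X≢[])) e , S , s , eq

-- If `l` can be matched at all, it can be matched at the first letter that reduces to it, since
-- this leaves a longer rest for `X`.
ending-∷ : ∀ {b l X} → unc b ∈ l ∷ X → X ≢ [] → Ending (l ∷ X) ⟺ Hit l ∙ Ending X
ending-∷ {l = l} {X} b∈ X≢[] = mk⇔ split join
  where
  greedy : ∀ {T Z} → All PosPart Z → (l ∷ T) ≼ Z → ∃₂ λ u v → Z ≡ u ++ v × Hit l u × T ≼ v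
  greedy (p ∷ _)  (r ∷ s)    = _ , _ , refl , hit p r , s
  greedy (p ∷ ps) (skip z s) with reduce? z l
  -- The earlier letter `z` takes over the role of the later one, which is dropped from the
  -- embedding.
  ... | yes r = [ z ] , _ , refl , hit p r , Sublist.∷ˡ⁻ s
  ... | no ¬r = let (u , v , eq , h , t) = greedy ps s in z ∷ u , v , cong (z ∷_) eq , miss p ¬r h , t

  split : ∀ {Z} → Ending (l ∷ X) Z → (Hit l ∙ Ending X) Z
  split (p , e , S , s , eq) with T , refl , eq' ← expandLast-uncons S eq b∈ X≢[]
    with u , v , refl , h , t ← greedy p s
    = u , v , refl , h , ending-++⁻ u X≢[] p e (T , t , eq')

  extend : ∀ {u v T} → Hit l u → T ≼ v → (l ∷ T) ≼ u ++ v
  extend (hit _ r)    t = r ∷ t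
  extend (miss _ _ h) t = skip _ (extend h t)

  join : ∀ {Z} → (Hit l ∙ Ending X) Z → Ending (l ∷ X) Z
  join (u , v , refl , h , p , e , T , t , eq) =
    All.++⁺ (hit-positive h) p , endsCircled-++ u e , l ∷ T , extend h t ,
    trans (cong (l ∷_) eq) (sym (expandLast-++ [ l ] {T} (expandLast-nonempty {S = T} eq X≢[])))

-- Peeling stops after the last uncircled part: up to there no term comes from an expansion, whereas
-- the final run of circles may, so it remains as one factor.
ending-hits : ∀ ms b k → Ending (ms ++ unc b ∷ circs (suc k)) ≃ Hits (ms ∷ʳ unc b) (Ending (circs (suc k)))
ending-hits []       b k = ⟺⇒≃ (ending-∷ (here refl) λ ())
ending-hits (m ∷ ms) b k =
  ≃-trans (⟺⇒≃ (ending-∷ (there (∈-++⁺ʳ ms (here refl))) (++-nonempty ms λ ())))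
    (∙-congʳ (hit-prefixFree m) (ending-hits ms b k))

-- The longest opening run that a selection can supply, starting from `s`. An uncircled `a` can be
-- expanded only as the first selected term, so it competes with everything before it; each circle
-- extends the run by one.
best : ℕ → List Part → ℕ
best s []          = s
best s (circ ∷ w)  = best (suc s) w
best s (unc a ∷ w) = best (s ⊔ a) w

best-++ : ∀ s u v → best s (u ++ v) ≡ best (best s u) v
best-++ s []          v = refl
best-++ s (circ ∷ u)  v = best-++ (suc s) u v
best-++ s (unc a ∷ u) v = best-++ (s ⊔ a) u v

climb-positive : ∀ {k s w} → Climb k s w → All PosPart w
climb-positive (done _)    = []
climb-positive (circ _ c)  = tt ∷ climb-positive c
climb-positive (unc _ p c) = p ∷ climb-positive c

climb⇒best : ∀ {k s w} → Climb k s w → k ≤ best s w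
climb⇒best (done p)    = p
climb⇒best (circ _ c)  = climb⇒best c
climb⇒best (unc _ _ c) = climb⇒best c

best⇒climb : ∀ k s w → All PosPart w → k ≤ best s w → ∃₂ λ u v → w ≡ u ++ v × Climb k s u
best⇒climb k s w ps p with k ≤? s
best⇒climb k s w           ps       p | yes k≤s = [] , w , refl , done k≤s
best⇒climb k s []          ps       p | no k≰s  = contradiction p k≰s
best⇒climb k s (circ ∷ w)  (_ ∷ ps) p | no k≰s  =
  let (u , v , eq , c) = best⇒climb k (suc s) w ps p in circ ∷ u , v , cong (circ ∷_) eq , circ (≰⇒> k≰s) c
best⇒climb k s (unc a ∷ w) (q ∷ ps) p | no k≰s  =
  let (u , v , eq , c) = best⇒climb k (s ⊔ a) w ps p in unc a ∷ u , v , cong (unc a ∷_) eq , unc (≰⇒> k≰s) q c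

circs-cancel : ∀ c k {a W X} → circs c ++ W ≡ circs k ++ unc a ∷ X →
               ∃[ j ] (c + j ≡ k × circs j ++ unc a ∷ X ≡ W)
circs-cancel zero    k       eq = k , refl , sym eq
circs-cancel (suc c) (suc k) eq = let (j , p , q) = circs-cancel c k (∷-injectiveʳ eq) in j , cong suc p , q

module _ {a : ℕ} {X : List Part} where

  private
    Rest : List Part → Set
    Rest S = unc a ∷ X ≡ expandLast S

  -- While `j` circles are still to be matched, each matched one raises the running value by one and
  -- skipped letters never lower it. Hence the value `s + j` is reached before the place where the
  -- pattern from `unc a` on is embedded.
  locate-circs : ∀ j s {S Z} → S ≼ Z → circs j ++ unc a ∷ X ≡ expandLast S →
                 ∃₂ λ u v → Z ≡ u ++ v × s + j ≤ best s u × Occurs Rest v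
  locate-circs zero s {S} {Z} t eq = [] , Z , refl , ≤-reflexive (+-identityʳ s) , S , t , eq
  locate-circs (suc j) s {[]} [] ()
  locate-circs (suc j) s (skip circ t) eq =
    let (u , v , p , q , o) = locate-circs (suc j) (suc s) t eq in
    circ ∷ u , v , cong (circ ∷_) p , ≤-trans (n≤1+n _) q , o
  locate-circs (suc j) s (skip (unc b) t) eq =
    let (u , v , p , q , o) = locate-circs (suc j) (s ⊔ b) t eq in
    unc b ∷ u , v , cong (unc b ∷_) p , ≤-trans (+-monoˡ-≤ (suc j) (m≤m⊔n s b)) q , o
  locate-circs (suc j) s {S} (r ∷ t) eq
    with T , refl , eq' ← expandLast-uncons S eq (there (∈-++⁺ʳ (circs j) (here refl))) (++-nonempty (circs j) λ ())
    with circ↦circ ← r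
    = let (u , v , p , q , o) = locate-circs j (suc s) t eq' in
      circ ∷ u , v , cong (circ ∷_) p , ≤-trans (≤-reflexive (+-suc s j)) q , o

  locate-unc : ∀ c s {T Z} → (unc c ∷ T) ≼ Z → ∃₂ λ u v → Z ≡ u ++ v × c ≤ best s u × T ≼ v
  locate-unc c s (skip circ t)    = let (u , v , p , q , o) = locate-unc c (suc s) t in
    circ ∷ u , v , cong (circ ∷_) p , q , o
  locate-unc c s (skip (unc b) t) = let (u , v , p , q , o) = locate-unc c (s ⊔ b) t in
    unc b ∷ u , v , cong (unc b ∷_) p , q , o
  locate-unc c s (unc↦unc {b} _ c≤b ∷ t) = [ unc b ] , _ , refl , m≤n⇒m≤o⊔n s c≤b , t

  locate : ∀ k {S Z} → S ≼ Z → circs k ++ unc a ∷ X ≡ expandEnds S →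
           ∃₂ λ u v → Z ≡ u ++ v × k ≤ best 0 u × Occurs Rest v
  locate k {[]}             t eq = contradiction eq (++-nonempty (circs k) λ ())
  locate k {p ∷ []}         t eq =
    contradiction (subst (unc a ∈_) eq (∈-++⁺ʳ (circs k) (here refl))) (unc∉expandPart p)
  locate k {circ ∷ q ∷ S}   t eq = locate-circs k 0 t eq
  -- The first term expands to `c` circles of the opening run, where `c ≤ k` because `unc a` ends
  -- that run. The remaining `j` circles are terms of the selection itself.
  locate k {unc c ∷ q ∷ S} {Z} t eq
    with j , refl , eq' ← circs-cancel c k (sym eq)
    with u , v , refl , c≤ , t' ← locate-unc c 0 t
    with u' , v' , refl , le , o ← locate-circs j (best 0 u) t' eq'
    = u ++ u' , v' , sym (++-assoc u u' v') ,
      subst (c + j ≤_) (sym (best-++ 0 u u')) (≤-trans (+-monoˡ-≤ j c≤) le) , o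

-- The selections that supply an opening run of `k` circles: either circles only, or one uncircled
-- term that is expanded, followed by circles.
data Opens : ℕ → List Part → Set where
  all-circled : ∀ k → Opens k (circs k)
  unc-first   : ∀ j i → Opens (suc j + i) (unc (suc j) ∷ circs i)

Available : List Part → ℕ → Set
Available u k = Occurs (Opens k) u

circs-∷ʳ : ∀ k → circs k ∷ʳ circ ≡ circs (suc k)
circs-∷ʳ zero    = refl
circs-∷ʳ (suc k) = cong (circ ∷_) (circs-∷ʳ k)

opens-suc : ∀ {k S} → Opens k S → Opens (suc k) (S ∷ʳ circ)
opens-suc (all-circled k) = subst (Opens (suc k)) (sym (circs-∷ʳ k)) (all-circled (suc k))
opens-suc (unc-first j i) = subst₂ Opens (+-suc (suc j) i) (cong (unc (suc j) ∷_) (sym (circs-∷ʳ i)))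
                              (unc-first j (suc i))

-- The converse of `locate`: whatever `best` promises can be realised. Here `u` is the portion
-- already read. All values up to `s` are carried along, since a new circle passes from `k` to
-- `suc k` and an uncircled part may be replaced by any smaller positive number.
available-best : ∀ u s w → (∀ {k} → k ≤ s → Available u k) → ∀ {k} → k ≤ best s w → Available (u ++ w) k
available-best u s []         av p = subst (λ x → Available x _) (sym (++-identityʳ u)) (av p)
available-best u s (circ ∷ w) av p =
  subst (λ x → Available x _) (++-assoc u [ circ ] w) (available-best (u ∷ʳ circ) (suc s) w av' p)
  where
  av' : ∀ {k} → k ≤ suc s → Available (u ∷ʳ circ) k
  av' {zero}  _       = [] , Sublist.Sublist-[]-universal _ , all-circled 0
  av' {suc k} (s≤s q) = let (S , t , o) = av q in S ∷ʳ circ , Sublist.++⁺ t (circ↦circ ∷ []) , opens-suc o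
available-best u s (unc a ∷ w) av p =
  subst (λ x → Available x _) (++-assoc u [ unc a ] w) (available-best (u ∷ʳ unc a) (s ⊔ a) w av' p)
  where
  single : ∀ {k} → k ≤ a → Available (u ∷ʳ unc a) k
  single {zero}  _ = [] , Sublist.Sublist-[]-universal _ , all-circled 0
  single {suc k} q = [ unc (suc k) ] , Sublist.++ˡ u (unc↦unc (s≤s z≤n) q ∷ []) ,
                     subst (λ n → Opens n [ unc (suc k) ]) (+-identityʳ (suc k)) (unc-first k 0)
  av' : ∀ {k} → k ≤ s ⊔ a → Available (u ∷ʳ unc a) k
  av' {k} q with ⊔-sel s a
  -- If the maximum is `s`, the new part is ignored; if it is `a`, the new part alone supplies the
  -- run and the earlier selection is discarded.
  ... | inj₁ eq = let (S , t , o) = av (subst (k ≤_) eq q) in S , Sublist.++ʳ [ unc a ] t , o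
  ... | inj₂ eq = single (subst (k ≤_) eq q)

expandEnds-opens : ∀ {k S T} → Opens (suc k) S → T ≢ [] → expandEnds (S ++ T) ≡ circs (suc k) ++ expandLast T
expandEnds-opens (all-circled (suc k)) T≢[] =
  trans (expandEnds-∷ circ (++-nonempty (circs k) T≢[])) (cong (circ ∷_) (expandLast-++ (circs k) T≢[]))
expandEnds-opens {T = T} (unc-first j i) T≢[] =
  trans (expandEnds-∷ (unc (suc j)) (++-nonempty (circs i) T≢[]))
    (trans (cong (circs (suc j) ++_) (expandLast-++ (circs i) T≢[]))
      (trans (sym (++-assoc (circs (suc j)) (circs i) _)) (cong (_++ expandLast T) (replicate-+ (suc j) i))))
  where
  replicate-+ : ∀ m n → circs m ++ circs n ≡ circs (m + n)
  replicate-+ zero    n = refl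
  replicate-+ (suc m) n = cong (circ ∷_) (replicate-+ m n)

-- The opening factor is cut off as soon as `suc k` circles are available. Letters between that
-- point and the embedding of the rest are handed to the ending, which tolerates letters in front.
dominating-opening : ∀ k a X → Dominating (circs (suc k) ++ unc a ∷ X) ⟺ Opening (suc k) ∙ Ending (unc a ∷ X)
dominating-opening k a X = mk⇔ split join
  where
  split : ∀ {Z} → Dominating (circs (suc k) ++ unc a ∷ X) Z → (Opening (suc k) ∙ Ending (unc a ∷ X)) Z
  split (p , st , e , d) with S , t , eq ← Equivalence.to Dominates⟺Occurs d
    with locate (suc k) t eq
  -- An empty prefix offers no circle, but `suc k` are required.
  ... | [] , _ , _ , () , _
  -- The prefix is nonempty, so its first letter is the circle that starts the word; this moves the
  -- climb to 1.
  split (p , (_ , refl) , e , d) | x ∷ u , v , refl , le , o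
    with u₁ , u₂ , refl , c ← best⇒climb (suc k) 1 u (All.++⁻ˡ u (All.tail p)) le
    = circ ∷ u₁ , u₂ ++ v , cong (circ ∷_) (++-assoc u₁ u₂ v) , (u₁ , refl , c) ,
      ending-++ u₂ (All.++⁻ʳ u₁ (All.++⁻ˡ (u₁ ++ u₂) (All.tail p)))
        (ending-++⁻ (circ ∷ u₁ ++ u₂) (λ ()) p e o)

  join : ∀ {Z} → (Opening (suc k) ∙ Ending (unc a ∷ X)) Z → Dominating (circs (suc k) ++ unc a ∷ X) Z
  join (_ , v , refl , (w , refl , c) , p , e , T , t , eq) =
    let (S , s , o) = available-best [] 0 (circ ∷ w) (λ { z≤n → [] , [] , all-circled 0 }) (climb⇒best c) in
    All.++⁺ (tt ∷ climb-positive c) p , (w ++ v , refl) , endsCircled-++ (circ ∷ w) e ,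
    Equivalence.from Dominates⟺Occurs (S ++ T , Sublist.++⁺ s t ,
      trans (cong (circs (suc k) ++_) eq) (sym (expandEnds-opens o (expandLast-nonempty eq λ ()))))

-- Reversal symmetry

reverse-circs : ∀ k → reverse (circs k) ≡ circs k
reverse-circs zero    = refl
reverse-circs (suc k) = trans (unfold-reverse circ (circs k)) (trans (cong (_∷ʳ circ) (reverse-circs k)) (circs-∷ʳ k))

reverse-expandPart : ∀ p → reverse (expandPart p) ≡ expandPart p
reverse-expandPart circ    = refl
reverse-expandPart (unc k) = reverse-circs k

expandEnds-∷-∷ʳ : ∀ p ms q → expandEnds (p ∷ ms ∷ʳ q) ≡ expandPart p ++ ms ++ expandPart q
expandEnds-∷-∷ʳ p ms q = trans (expandEnds-∷ p (++-nonempty ms λ ())) (cong (expandPart p ++_) (expandLast-++ ms λ ()))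

reverse-∷-∷ʳ : ∀ (p : Part) ms q → reverse (p ∷ ms ∷ʳ q) ≡ q ∷ reverse ms ∷ʳ p
reverse-∷-∷ʳ p ms q = trans (unfold-reverse p (ms ∷ʳ q)) (cong (_∷ʳ p) (reverse-++ ms [ q ]))

reverse-++-++ : ∀ (xs ys zs : List Part) → reverse (xs ++ ys ++ zs) ≡ reverse zs ++ reverse ys ++ reverse xs
reverse-++-++ xs ys zs = trans (reverse-++ xs (ys ++ zs))
  (trans (cong (_++ reverse xs) (reverse-++ ys zs)) (++-assoc (reverse zs) (reverse ys) (reverse xs)))

-- Inner terms are untouched by the expansion, and the two ends become runs of circles, which are
-- palindromes.
expandEnds-reverse : ∀ S → expandEnds (reverse S) ≡ reverse (expandEnds S)
expandEnds-reverse []      = refl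
expandEnds-reverse (p ∷ S) with initLast S
... | []       = sym (reverse-expandPart p)
... | ms ∷ʳ′ q = begin
  expandEnds (reverse (p ∷ ms ∷ʳ q))                            ≡⟨ cong expandEnds (reverse-∷-∷ʳ p ms q) ⟩
  expandEnds (q ∷ reverse ms ∷ʳ p)                              ≡⟨ expandEnds-∷-∷ʳ q (reverse ms) p ⟩
  expandPart q ++ reverse ms ++ expandPart p                    ≡⟨ cong₂ (λ x y → x ++ reverse ms ++ y) (reverse-expandPart q) (reverse-expandPart p) ⟨
  reverse (expandPart q) ++ reverse ms ++ reverse (expandPart p) ≡⟨ reverse-++-++ (expandPart p) ms (expandPart q) ⟨
  reverse (expandPart p ++ ms ++ expandPart q)                  ≡⟨ cong reverse (expandEnds-∷-∷ʳ p ms q) ⟨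
  reverse (expandEnds (p ∷ ms ∷ʳ q))                            ∎
  where open ≡-Reasoning

size-reverse : ∀ z → size (reverse z) ≡ size z
size-reverse z = sum-↭ (Perm.map⁺ weight (Perm.↭-reverse z))

dominating-reverse⁺ : ∀ {X Z} → Dominating X Z → Dominating (reverse X) (reverse Z)
dominating-reverse⁺ {X} (p , (ys , refl) , (zs , e) , d) =
  let (S , s , eq) = Equivalence.to Dominates⟺Occurs d in
  Perm.All-resp-↭ (↭-sym (Perm.↭-reverse _)) p ,
  (reverse zs , trans (cong reverse e) (reverse-++ zs [ circ ])) ,
  (reverse ys , unfold-reverse circ ys) ,
  Equivalence.from Dominates⟺Occurs
    (reverse S , Sublist.reverse⁺ s , trans (cong reverse eq) (sym (expandEnds-reverse S)))

dominating-reverse : ∀ X → Dominating X ≃ Dominating (reverse X)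
dominating-reverse X = record
  { Graph      = λ z z' → z' ≡ reverse z
  ; to         = λ d → _ , dominating-reverse⁺ d , refl
  ; from       = λ {z'} d → reverse z' ,
                   subst (λ X → Dominating X _) (reverse-involutive X) (dominating-reverse⁺ d) ,
                   sym (reverse-involutive z')
  ; functional = λ { refl refl → refl }
  ; injective  = λ p q → reverse-injective (trans (sym p) q)
  ; size-≡     = λ { {z} refl → sym (size-reverse z) }
  }

-- Normal forms

-- Unlike a dominated composition, a shape does not require uncircled parts at both ends of `ls`.
-- Parts can thus be permuted and traded freely, and a framed arrangement leads back to a circled
-- composition.
Shape : ℕ → List Part → ℕ → Lang
Shape k ls k' = Opening k ∙ Hits ls (Ending (circs k'))

shape-↭ : ∀ {k ls ls' k'} → ls ↭ ls' → Shape k ls k' ≃ Shape k ls' k'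
shape-↭ {k} p = ∙-congʳ (opening-prefixFree k) (hits-↭ p)

shape-2 : ∀ ls k' → Shape 2 ls k' ≃ Shape 1 (unc 1 ∷ ls) k'
shape-2 ls k' = ≃-trans
  (∙-cong (opening-prefixFree 2) (∙-prefixFree (opening-prefixFree 1) (hit-prefixFree (unc 1))) opening-2 ≃-refl)
  (⟺⇒≃ ∙-assoc)

data Framed : List Part → Set where
  single : ∀ a → Framed [ unc a ]
  many   : ∀ a xs b → Framed (unc a ∷ xs ∷ʳ unc b)

framed-first : ∀ {ls} → Framed ls → ∃₂ λ a xs → ls ≡ unc a ∷ xs
framed-first (single a)    = a , [] , refl
framed-first (many a xs b) = a , _ , refl

framed-last : ∀ {ls} → Framed ls → ∃₂ λ xs b → ls ≡ xs ∷ʳ unc b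
framed-last (single b)    = [] , b , refl
framed-last (many a xs b) = unc a ∷ xs , b , refl

framed-reverse : ∀ {ls} → Framed ls → Framed (reverse ls)
framed-reverse (single a)    = single a
framed-reverse (many a xs b) = subst Framed (sym (reverse-∷-∷ʳ (unc a) xs (unc b))) (many b (reverse xs) a)

-- The first uncircled part marks the end of the opening run, the last one the beginning of the
-- final run; between them every part contributes its own factor.
dominating-shape : ∀ {k ls k'} → Framed ls → 1 ≤ k → 1 ≤ k' →
                   Dominating (circs k ++ ls ++ circs k') ≃ Shape k ls k'
dominating-shape {suc k} {ls} {suc k'} fr _ _
  with a , xs , refl ← framed-first fr with ms , b , eq ← framed-last fr =
  ≃-trans (⟺⇒≃ (dominating-opening k a (xs ++ circs (suc k'))))
    (∙-congʳ (opening-prefixFree (suc k))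
      (subst (λ ls → Ending (ls ++ circs (suc k')) ≃ Hits ls (Ending (circs (suc k')))) (sym eq)
        (subst (λ X → Ending X ≃ Hits (ms ∷ʳ unc b) (Ending (circs (suc k')))) (sym (++-assoc ms [ unc b ] _)) (ending-hits ms b k'))))

dominating-flip : ∀ k ls k' → Dominating (circs k ++ ls ++ circs k') ≃ Dominating (circs k' ++ reverse ls ++ circs k)
dominating-flip k ls k' = subst (λ X → Dominating (circs k ++ ls ++ circs k') ≃ Dominating X)
  (trans (reverse-++-++ (circs k) ls (circs k'))
    (cong₂ (λ x y → x ++ reverse ls ++ y) (reverse-circs k') (reverse-circs k)))
  (dominating-reverse _)

-- The shape itself has no visible symmetry, so the exchange passes through `Dominating`, where
-- reversal applies, and then permutes the reversed parts back. It makes moves on the opening run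
-- available for the final run.
shape-flip : ∀ {k ls k'} → Framed ls → 1 ≤ k → 1 ≤ k' → Shape k ls k' ≃ Shape k' ls k
shape-flip {k} {ls} {k'} fr p q =
  ≃-trans (≃-sym (dominating-shape fr p q)) (≃-trans (dominating-flip k ls k')
    (≃-trans (dominating-shape (framed-reverse fr) q p) (shape-↭ (Perm.↭-reverse ls))))

framing : ∀ X → (∃[ k ] X ≡ circs k) ⊎ (∃[ k ] ∃[ ls ] ∃[ k' ] (X ≡ circs k ++ ls ++ circs k' × Framed ls))
framing [] = inj₁ (0 , refl)
framing (circ ∷ X) with framing X
... | inj₁ (k , eq)                = inj₁ (suc k , cong (circ ∷_) eq)
... | inj₂ (k , ls , k' , eq , fr) = inj₂ (suc k , ls , k' , cong (circ ∷_) eq , fr)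
framing (unc a ∷ X) with framing X
... | inj₁ (k , refl) = inj₂ (0 , [ unc a ] , k , refl , single a)
-- A new uncircled part in front turns the former opening run into inner circles.
... | inj₂ (k , ls , k' , refl , fr) with ms , b , refl ← framed-last fr =
  inj₂ (0 , unc a ∷ (circs k ++ ms) ∷ʳ unc b , k' ,
        cong (unc a ∷_) (trans (sym (++-assoc (circs k) _ _)) (cong (_++ circs k') (sym (++-assoc (circs k) ms _)))) ,
        many a (circs k ++ ms) b)

size-circs : ∀ k → size (circs k) ≡ k
size-circs zero    = refl
size-circs (suc k) = cong suc (size-circs k)

size-uncs : ∀ us → size (uncs us) ≡ sum us
size-uncs []       = refl
size-uncs (u ∷ us) = cong (u +_) (size-uncs us)

size-frame : ∀ k ls k' → size (circs k ++ ls ++ circs k') ≡ k + (size ls + k')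
size-frame k ls k' = trans (size-circs-++ k _)
  (cong (k +_) (trans (size-++ ls (circs k')) (cong (size ls +_) (size-circs k'))))

size-↭ : ∀ {ls ls'} → ls ↭ ls' → size ls ≡ size ls'
size-↭ p = sum-↭ (Perm.map⁺ weight p)

circs-positive : ∀ k → All PosPart (circs k)
circs-positive zero    = []
circs-positive (suc k) = tt ∷ circs-positive k

isCC-frame : ∀ {n k ls k'} → 1 ≤ k → 1 ≤ k' → All PosPart ls → k + (size ls + k') ≡ n →
             IsCC n (circs k ++ ls ++ circs k')
isCC-frame {k = suc k} {ls} {suc k'} _ _ p eq =
  All.++⁺ (circs-positive (suc k)) (All.++⁺ p (circs-positive (suc k'))) ,
  (_ , refl) ,
  endsCircled-++ (circs (suc k)) (endsCircled-++ ls (circs k' , sym (circs-∷ʳ k'))) ,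
  trans (size-frame (suc k) ls (suc k')) eq

isCC-framing : ∀ {n X} → IsCC n X → X ≡ circs n ⊎
  (∃[ k ] ∃[ ls ] ∃[ k' ] (X ≡ circs k ++ ls ++ circs k' × Framed ls × 1 ≤ k × 1 ≤ k' ×
    All PosPart ls × k + (size ls + k') ≡ n))
isCC-framing {n} {X} (p , (_ , st) , (zs , en) , sz) with framing X
... | inj₁ (k , refl) = inj₁ (cong circs (trans (sym (size-circs k)) sz))
... | inj₂ (k , ls , k' , refl , fr) =
  inj₂ (k , ls , k' , refl , fr , left k st , right k' {circs k} en ,
        All.++⁻ˡ ls (All.++⁻ʳ (circs k) p) , trans (sym (size-frame k ls k')) sz)
  where
  left : ∀ k {ys Z} → circs k ++ ls ++ Z ≡ circ ∷ ys → 1 ≤ k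
  left zero    eq with _ , _ , refl ← framed-first fr with () ← eq
  left (suc k) _  = s≤s z≤n
  right : ∀ k' {Z} → Z ++ ls ++ circs k' ≡ zs ∷ʳ circ → 1 ≤ k'
  right (suc k') _ = s≤s z≤n
  right zero {Z} eq with ms , b , refl ← framed-last fr
    with () ← ∷ʳ-injectiveʳ (Z ++ ms) zs (trans (++-assoc Z ms [ unc b ])
                (trans (cong (Z ++_) (sym (++-identityʳ _))) eq))

-- Bags of parts and their decreasing arrangement

bag : List ℕ → ℕ → List Part
bag us c = uncs us ++ circs c

size-bag : ∀ us c → size (bag us c) ≡ sum us + c
size-bag us c = trans (size-++ (uncs us) (circs c)) (cong₂ _+_ (size-uncs us) (size-circs c))

uncs-positive : ∀ {us} → All (1 ≤_) us → All PosPart (uncs us)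
uncs-positive = All.map⁺

↭-bag : ∀ ls → All PosPart ls → ∃₂ λ us c → ls ↭ bag us c × All (1 ≤_) us
↭-bag []           []       = [] , 0 , ↭-refl , []
↭-bag (circ ∷ ls)  (_ ∷ ps) = let (us , c , p , q) = ↭-bag ls ps in
  us , suc c , ↭-trans (prep circ p) (↭-sym (Perm.shift circ (uncs us) (circs c))) , q
↭-bag (unc a ∷ ls) (p ∷ ps) = let (us , c , q , r) = ↭-bag ls ps in a ∷ us , c , prep (unc a) q , p ∷ r

-- Each 2 becomes a 1 and a further circle. The number of uncircled parts is preserved, so a bag
-- that can be framed stays so.
remove-twos : ∀ {T} us c → All (1 ≤_) us → ∃₂ λ us' c' → length us' ≡ length us × All (1 ≤_) us' ×
              All (_≢ 2) us' × sum us' + c' ≡ sum us + c × Hits (bag us c) T ≃ Hits (bag us' c') T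
remove-twos []       c []       = [] , c , refl , [] , [] , refl , ≃-refl
remove-twos {T} (u ∷ us) c (p ∷ ps) with u ≟ 2
... | no u≢2 =
  let (us' , c' , len , pos , ≢2 , eq , e) = remove-twos us c ps in
  u ∷ us' , c' , cong suc len , p ∷ pos , u≢2 ∷ ≢2 ,
  trans (+-assoc u _ _) (trans (cong (u +_) eq) (sym (+-assoc u _ _))) ,
  ∙-congʳ (hit-prefixFree (unc u)) e
... | yes refl =
  let (us' , c' , len , pos , ≢2 , eq , e) = remove-twos us (suc c) ps in
  1 ∷ us' , c' , cong suc len , s≤s z≤n ∷ pos , (λ ()) ∷ ≢2 ,
  cong suc (trans eq (+-suc (sum us) c)) ,
  ≃-trans (∙-cong (hit-prefixFree (unc 2)) (∙-prefixFree (hit-prefixFree circ) (hit-prefixFree (unc 1))) hit-unc2 ≃-refl)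
    (≃-trans (⟺⇒≃ ∙-assoc)
      -- The new circle moves past the 1 and then joins the circles at the end of the bag, which
      -- matches the recursive call with `suc c`.
      (≃-trans (hits-↭ {T} {circ ∷ unc 1 ∷ bag us c} (swap circ (unc 1) ↭-refl))
        (∙-congʳ (hit-prefixFree (unc 1))
          (≃-trans (hits-↭ (↭-sym (Perm.shift circ (uncs us) (circs c)))) e))))

module ≥-Sort = Data.List.Sort (Flip.decTotalOrder ≤-decTotalOrder)

-- All inner circles are placed just before the smallest uncircled part, as form (2) demands. Two
-- uncircled parts are needed so that one stands on either side of the circles.
arrange : ∀ us c → 2 ≤ length us → ∃₂ λ as b → Decreasing (as ∷ʳ b) × as ∷ʳ b ↭ us ×
          (uncs as ++ circs c) ∷ʳ unc b ↭ bag us c × Framed ((uncs as ++ circs c) ∷ʳ unc b)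
arrange us c len
  with ≥-Sort.sort us | ≥-Sort.sort-↭ us | ≥-Sort.sort-↗ us
... | vs | p | s with initLast vs
... | []            = contradiction (subst (2 ≤_) (sym (Perm.↭-length p)) len) λ ()
... | [] ∷ʳ′ b       = contradiction (subst (2 ≤_) (sym (Perm.↭-length p)) len) λ { (s≤s ()) }
... | (a ∷ as) ∷ʳ′ b = a ∷ as , b , s , p , perm , many a (uncs as ++ circs c) b
  where
  perm : (uncs (a ∷ as) ++ circs c) ∷ʳ unc b ↭ bag us c
  perm = ↭-trans (↭-reflexive (++-assoc (uncs (a ∷ as)) (circs c) [ unc b ]))
    (↭-trans (Perm.++⁺ˡ (uncs (a ∷ as)) (Perm.++-comm (circs c) [ unc b ]))
      (↭-trans (↭-reflexive (sym (++-assoc (uncs (a ∷ as)) [ unc b ] (circs c))))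
        (Perm.++⁺ʳ (circs c) (↭-trans (↭-reflexive (sym (map-++ unc (a ∷ as) [ b ]))) (Perm.map⁺ unc p)))))

-- The state of the normalisation: two end runs and a bag with at least two uncircled parts, which
-- can therefore be framed whenever a flip or the final composition requires it.
record Presentation (n : ℕ) (X : List Part) (k : ℕ) (us : List ℕ) (c k' : ℕ) : Set₁ where
  field
    left     : 1 ≤ k
    right    : 1 ≤ k'
    two      : 2 ≤ length us
    positive : All (1 ≤_) us
    total    : k + ((sum us + c) + k') ≡ n
    equiv    : Dominating X ≃ Shape k (bag us c) k'

open Presentation

-- A bag with circles ends in a circle and is not framed, so it is arranged before the flip and
-- restored afterwards.
present-flip : ∀ {n X k us c k'} → Presentation n X k us c k' → Presentation n X k' us c k
present-flip {k = k} {us} {c} {k'} P = let (_ , _ , _ , _ , perm , fr) = arrange us c (two P) in record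
  { left     = right P
  ; right    = left P
  ; two      = two P
  ; positive = positive P
  ; total    = trans (trans (+-comm k' _) (trans (cong (_+ k') (+-comm _ k)) (+-assoc k _ k'))) (total P)
  ; equiv    = ≃-trans (equiv P) (≃-trans (shape-↭ (↭-sym perm))
                 (≃-trans (shape-flip fr (left P) (right P)) (shape-↭ perm)))
  }

present-left≢2 : ∀ {n X k us c k'} → Presentation n X k us c k' →
                 ∃₂ λ l vs → l ≢ 2 × Presentation n X l vs c k'
present-left≢2 {k = k} {us} {c} {k'} P with k ≟ 2
... | no k≢2   = k , us , k≢2 , P
... | yes refl = 1 , 1 ∷ us , (λ ()) , record
  { left     = s≤s z≤n
  ; right    = right P
  ; two      = m≤n⇒m≤1+n (two P)
  ; positive = s≤s z≤n ∷ positive P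
  ; total    = total P
  ; equiv    = ≃-trans (equiv P) (shape-2 (bag us c) k')
  }

present-twos : ∀ {n X k us c k'} → Presentation n X k us c k' →
               ∃₂ λ vs d → All (_≢ 2) vs × Presentation n X k vs d k'
present-twos {k = k} {us} {c} {k'} P =
  let (vs , d , len , pos , ≢2 , eq , e) = remove-twos us c (positive P) in vs , d , ≢2 , record
  { left     = left P
  ; right    = right P
  ; two      = subst (2 ≤_) (sym len) (two P)
  ; positive = pos
  ; total    = trans (cong (λ x → k + (x + k')) eq) (total P)
  ; equiv    = ≃-trans (equiv P) (∙-congʳ (opening-prefixFree k) e)
  }

Normalisable : ℕ → List Part → Set
Normalisable n X = ∃[ Y ] (IsCC n Y × (Form1 n Y ⊎ Form2 Y ⊎ Form3 Y) × WilfEquiv X Y)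

present-form2 : ∀ {n X k us c k'} → k' ≤ k → k ≢ 2 → k' ≢ 2 → All (_≢ 2) us →
                Presentation n X k us c k' → Normalisable n X
present-form2 {n} {X} {k} {us} {c} {k'} k'≤k k≢2 k'≢2 ≢2 P
  with as , b , dec , p , perm , fr ← arrange us c (two P) =
  Y , subst (IsCC n) Y≡ (isCC-frame (left P) (right P) pos
        (trans (cong (λ x → k + (x + k')) (trans (size-↭ perm) (size-bag us c))) (total P))) ,
  inj₂ (inj₁ (k , c , k' , as , b , refl , k'≤k , dec , Perm.All-resp-↭ (↭-sym p) ≢2 , k≢2 , k'≢2)) ,
  ≃⇒WilfEquiv (≃-trans (equiv P) (≃-trans (shape-↭ (↭-sym perm))
    (subst (λ Y → Shape k ls k' ≃ Dominating Y) Y≡ (≃-sym (dominating-shape fr (left P) (right P))))))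
  where
  ls Y : List Part
  ls = (uncs as ++ circs c) ∷ʳ unc b
  Y  = circs k ++ uncs as ++ circs c ++ unc b ∷ circs k'
  Y≡ : circs k ++ ls ++ circs k' ≡ Y
  Y≡ = cong (circs k ++_) (trans (++-assoc (uncs as ++ circs c) [ unc b ] (circs k'))
         (++-assoc (uncs as) (circs c) _))
  pos : All PosPart ls
  pos = Perm.All-resp-↭ (↭-sym perm) (All.++⁺ (uncs-positive (positive P)) (circs-positive c))

-- The end runs are repaired one after the other. Removing the 2s comes last, also catching any 2
-- present from the start, and changes only the bag, so both runs keep a length other than 2. A last
-- flip, if needed, puts the longer run first.
present-normalisable : ∀ {n X k us c k'} → Presentation n X k us c k' → Normalisable n X
present-normalisable P₀
  with k , _ , k≢2 , P₁ ← present-left≢2 P₀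
  with k' , _ , k'≢2 , P₂ ← present-left≢2 (present-flip P₁)
  with _ , _ , ≢2 , P₃ ← present-twos P₂
  with ≤-total k k'
... | inj₁ k≤k' = present-form2 k≤k' k'≢2 k≢2 ≢2 P₃
... | inj₂ k'≤k = present-form2 k'≤k k≢2 k'≢2 ≢2 (present-flip P₃)

-- A lone 2 cannot be traded, since 1° and 1 have no framed arrangement; form (3) allows it because
-- its condition on 2s starts at two uncircled parts.
single-form3 : ∀ {n X k a k'} → 1 ≤ k → 1 ≤ k' → 1 ≤ a → k + (a + k') ≡ n → k' ≤ k → k ≢ 2 → k' ≢ 2 →
               Dominating X ≃ Dominating (circs k ++ unc a ∷ circs k') → Normalisable n X
single-form3 {k = k} {a} {k'} p q r eq k'≤k k≢2 k'≢2 e =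
  circs k ++ unc a ∷ circs k' ,
  isCC-frame p q (r ∷ []) (trans (cong (λ x → k + (x + k')) (+-identityʳ a)) eq) ,
  inj₂ (inj₂ (k , k' , [ a ] , refl , k'≤k , k≢2 , k'≢2 , [-] , λ { (s≤s ()) })) ,
  ≃⇒WilfEquiv e

-- An opening (1°)² yields an extra part 1, hence the second uncircled part that the general
-- procedure requires.
single-present : ∀ {n X a k'} → 1 ≤ k' → 1 ≤ a → 2 + (a + k') ≡ n →
                 Dominating X ≃ Dominating (circs 2 ++ unc a ∷ circs k') → Presentation n X 1 (1 ∷ a ∷ []) 0 k'
single-present {a = a} {k'} q r eq e = record
  { left     = s≤s z≤n
  ; right    = q
  ; two      = s≤s (s≤s z≤n)
  ; positive = s≤s z≤n ∷ r ∷ []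
  ; total    = trans (cong (λ x → 2 + (x + k')) (trans (+-identityʳ (a + 0)) (+-identityʳ a))) eq
  ; equiv    = ≃-trans e (≃-trans (dominating-shape (single a) (s≤s z≤n) q) (shape-2 [ unc a ] k'))
  }

single-normalisable : ∀ {n k a k'} → 1 ≤ k → 1 ≤ k' → 1 ≤ a → k + (a + k') ≡ n →
                      Normalisable n (circs k ++ unc a ∷ circs k')
single-normalisable {n} {k} {a} {k'} p q r eq with k ≟ 2 | k' ≟ 2
... | yes refl | _        = present-normalisable (single-present q r eq ≃-refl)
... | no _     | yes refl = present-normalisable (single-present p r eq' (dominating-flip k [ unc a ] 2))
  where
  eq' : 2 + (a + k) ≡ n
  eq' = trans (trans (+-comm 2 _) (trans (cong (_+ 2) (+-comm a k)) (+-assoc k a 2))) eq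
... | no k≢2   | no k'≢2 with ≤-total k' k
...   | inj₁ k'≤k = single-form3 p q r eq k'≤k k≢2 k'≢2 ≃-refl
...   | inj₂ k≤k' = single-form3 q p r eq' k≤k' k'≢2 k≢2 (dominating-flip k [ unc a ] k')
  where
  eq' : k' + (a + k) ≡ n
  eq' = trans (trans (+-comm k' _) (trans (cong (_+ k') (+-comm a k)) (+-assoc k a k'))) eq

framed-normalisable : ∀ {n k ls k'} → Framed ls → 1 ≤ k → 1 ≤ k' → All PosPart ls → k + (size ls + k') ≡ n →
                      Normalisable n (circs k ++ ls ++ circs k')
framed-normalisable {k = k} {k' = k'} (single a) p q (r ∷ []) eq =
  single-normalisable p q r (trans (cong (λ x → k + (x + k')) (sym (+-identityʳ a))) eq)
-- The two framing parts `a` and `b` guarantee two uncircled parts in the bag, whatever `xs`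
-- contains.
framed-normalisable {k = k} {k' = k'} (many a xs b) p q (r ∷ rs) eq
  with us , c , perm , pos ← ↭-bag xs (All.++⁻ˡ xs rs) = present-normalisable record
  { left     = p
  ; right    = q
  ; two      = s≤s (s≤s z≤n)
  ; positive = r ∷ All.head (All.++⁻ʳ xs rs) ∷ pos
  ; total    = trans (cong (λ x → k + (x + k')) (sym (trans (size-↭ perm') (size-bag (a ∷ b ∷ us) c)))) eq
  ; equiv    = ≃-trans (dominating-shape (many a xs b) p q) (shape-↭ perm')
  }
  where
  perm' : unc a ∷ xs ∷ʳ unc b ↭ bag (a ∷ b ∷ us) c
  perm' = prep (unc a) (↭-trans (Perm.++-comm xs [ unc b ]) (prep (unc b) perm))

theorem4p25 : (n : ℕ) → 1 ≤ n → (X : List Part) → IsCC n X →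
    ∃[ Y ] (IsCC n Y × (Form1 n Y ⊎ Form2 Y ⊎ Form3 Y) × WilfEquiv X Y)
theorem4p25 n _ X cc with isCC-framing cc
... | inj₁ eq = X , cc , inj₁ eq , ≃⇒WilfEquiv ≃-refl
... | inj₂ (k , ls , k' , refl , fr , p , q , pos , eq) = framed-normalisable fr p q pos eq
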